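{- For every prime power $q\ge 2$, there is no $5$-$(24,8,1)_q$ design (i.e. the large Witt design, with parameters $5$-$(24,8,1)$, has no $q$-analog).
   Context: For a $v$-dimensional vector space $V$ over the finite field $\mathrm{GF}(q)$, a pair $(V,\mathcal{B})$ with $\mathcal{B}$ a set of $k$-dimensional subspaces of $V$ (called blocks) is a $t$-$(v,k,\lambda)_q$ (subspace) design if every $t$-dimensional subspace of $V$ is contained in exactly $\lambda$ elements of $\mathcal{B}$. -}

module Defs where

open import Algebra.Apartness.Bundles using (HeytingCommutativeRing; HeytingField)
open import Algebra.Module.Bundles using (Module)
import Algebra.Properties.CommutativeMonoid.Sum as Sum
open import Data.Fin.Base using (Fin)
open import Data.Nat.Base using (ℕ; suc; _^_)
open import Data.Nat.Primality using (Prime)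
open import Data.Product.Base using (Σ; ∃-syntax; _×_; proj₁)
open import Data.Vec.Functional using (Vector)
open import Function.Bundles using (Inverse)
open import Level using (Level; _⊔_) renaming (suc to lsuc)
open import Relation.Binary.Bundles using (Setoid)
open import Relation.Binary.Definitions using (_Respects_)
import Relation.Binary.Construct.On as On
import Relation.Binary.PropositionalEquality.Properties as ≡
open import Relation.Binary.PropositionalEquality.Core using (_≡_)
open import Relation.Unary using (Pred; _∈_; _⊆_; U)
open import Relation.Unary.Relation.Binary.Equality using (≐-setoid)

private
  variable
    c ℓ₁ ℓ₂ m ℓm : Level

IsPrimePower : ℕ → Set
IsPrimePower q = ∃[ p ] ∃[ e ] Prime p × q ≡ p ^ suc e

HasSize : ∀ {a ℓ} → Setoid a ℓ → ℕ → Set (a ⊔ ℓ)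
HasSize S n = Inverse S (≡.setoid (Fin n))

-- For a ring of finite size equality is decidable, so the apartness of a
-- Heyting field is forced to be inequality: a Heyting field of size q is
-- exactly a field with q elements, that is, GF(q).
HasOrder : HeytingField c ℓ₁ ℓ₂ → ℕ → Set (c ⊔ ℓ₁)
HasOrder F = HasSize (HeytingField.setoid F)

VectorSpace : HeytingField c ℓ₁ ℓ₂ → (m ℓm : Level) → Set (c ⊔ ℓ₁ ⊔ lsuc (m ⊔ ℓm))
VectorSpace F = Module (HeytingCommutativeRing.commutativeRing (HeytingField.heytingCommutativeRing F))

module _ (F : HeytingField c ℓ₁ ℓ₂) (V : VectorSpace F m ℓm) where

  open HeytingField F using (_≈_; 0#) renaming (Carrier to K)
  open Module V
  open Sum +ᴹ-commutativeMonoid using (sum)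

  linearCombination : ∀ {n} → Vector K n → Vector Carrierᴹ n → Carrierᴹ
  linearCombination a v = sum (λ i → a i *ₗ v i)

  record IsBasis {s n} (W : Pred Carrierᴹ s) (v : Vector Carrierᴹ n) : Set (c ⊔ ℓ₁ ⊔ m ⊔ ℓm ⊔ s) where
    field
      members     : ∀ i → v i ∈ W
      independent : ∀ a → linearCombination a v ≈ᴹ 0ᴹ → ∀ i → a i ≈ 0#
      spanning    : ∀ {x} → x ∈ W → ∃[ a ] x ≈ᴹ linearCombination a v

  HasDimension : ∀ {s} → Pred Carrierᴹ s → ℕ → Set (c ⊔ ℓ₁ ⊔ m ⊔ ℓm ⊔ s)
  HasDimension W n = ∃[ v ] IsBasis {n = n} W v

  -- The span of a finite family is a predicate of level c ⊔ ℓm, so every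
  -- finite-dimensional subspace is represented at this level.
  record Subspace : Set (m ⊔ lsuc (c ⊔ ℓm)) where
    field
      ⟦_⟧       : Pred Carrierᴹ (c ⊔ ℓm)
      resp-≈ᴹ   : ⟦_⟧ Respects _≈ᴹ_
      0ᴹ-closed : 0ᴹ ∈ ⟦_⟧
      +ᴹ-closed : ∀ {x y} → x ∈ ⟦_⟧ → y ∈ ⟦_⟧ → (x +ᴹ y) ∈ ⟦_⟧
      *ₗ-closed : ∀ a {x} → x ∈ ⟦_⟧ → (a *ₗ x) ∈ ⟦_⟧

  open Subspace using (⟦_⟧)

  subspaceSetoid : Setoid _ _
  subspaceSetoid = On.setoid (≐-setoid Carrierᴹ (c ⊔ ℓm)) ⟦_⟧

  open Setoid subspaceSetoid using () renaming (_≈_ to _≐ₛ_)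

  blocksContaining : ∀ {b} → Pred Subspace b → Subspace → Setoid _ _
  blocksContaining 𝓑 T =
    On.setoid {B = Σ Subspace λ W → W ∈ 𝓑 × ⟦ T ⟧ ⊆ ⟦ W ⟧} subspaceSetoid proj₁

  record IsSubspaceDesign {b} (𝓑 : Pred Subspace b) (t v k l : ℕ) : Set (b ⊔ ℓ₁ ⊔ m ⊔ lsuc (c ⊔ ℓm)) where
    field
      dimension      : HasDimension U v
      blocks-resp    : 𝓑 Respects _≐ₛ_
      blockDimension : ∀ {W} → W ∈ 𝓑 → HasDimension ⟦ W ⟧ k
      balanced       : ∀ T → HasDimension ⟦ T ⟧ t → HasSize (blocksContaining 𝓑 T) l

{-# OPTIONS --safe #-}
-- Fix an independent pair in V. Every ordered triple extending it to an independent
-- 5-tuple lies in exactly one block, so "lying in a common block" is an equivalence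
-- relation on such triples, and a class consists of all such triples inside one
-- 8-dimensional block. Counting triples,
--   (q⁸ - q²)(q⁸ - q³)(q⁸ - q⁴)  divides  (q²⁴ - q²)(q²⁴ - q³)(q²⁴ - q⁴),
-- that is, with [k] = 1 + q + … + q^(k-1), [6][5][4] divides [22][21][20].
-- Cancelling [2][3][4], the value Φ₆ = q² - q + 1 of the sixth cyclotomic polynomial
-- would divide [11] in q², times [7] in q³, times [5] in q⁴. This product is a unit
-- modulo Φ₆, since q³ ≡ -1, whereas Φ₆ > 1.
module Submission where

open import Defs
open import Algebra.Apartness.Bundles using (HeytingCommutativeRing; HeytingField)
open import Algebra.Bundles using (CommutativeRing)
open import Algebra.Module.Bundles using (Module)
import Algebra.Properties.CommutativeMonoid.Sum as Sum
open import Data.Fin.Base using (Fin; zero; suc; finToFun; funToFin; combine; _↑ʳ_)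
open import Data.Fin.Properties using (any?; all?; finToFun-funToFin; funToFin-finToFin; _≟_)
open import Data.List.Base using (List; []; _∷_; length; filter; map; concatMap; allFin)
open import Data.List.Membership.Propositional using () renaming (_∈_ to _∈ₗ_)
open import Data.List.Membership.Propositional.Properties using (∈-filter⁺; ∈-filter⁻; ∈-map⁺; ∈-map⁻; ∈-allFin)
open import Data.List.Membership.Propositional.Properties.WithK using (unique∧set⇒bag)
open import Data.List.Properties using
  (filter-accept; filter-reject; filter-all; filter-none; filter-≐; filter-++; length-++; length-filter; length-map; length-tabulate)
open import Data.List.Relation.Binary.BagAndSetEquality using (∼bag⇒↭)
open import Data.List.Relation.Binary.Permutation.Propositional.Properties using (↭-length)
open import Data.List.Relation.Unary.All as All using (All; []; _∷_)
import Data.List.Relation.Unary.All.Properties as All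
import Data.List.Relation.Unary.Unique.Propositional.Properties as Unique
open import Data.Nat.Base using (ℕ; zero; suc; _+_; _*_; _∸_; _^_; _≤_; s≤s⁻¹; NonZero; ≢-nonZero⁻¹; nonTrivial⇒n>1)
open import Data.Nat.Divisibility using (_∣_; divides; ∣-refl; _∣0; ∣1⇒≡1; ∣m⇒∣m*n; ∣n⇒∣m*n; n∣m*n; ∣m∣n⇒∣m+n; ∣m+n∣m⇒∣n; m*n∣⇒m∣; *-cancelˡ-∣)
open import Data.Nat.Primality using (prime⇒nonTrivial; prime⇒nonZero)
open import Data.Nat.Properties using
  (≤-refl; ≤-trans; suc-injective; +-comm; +-suc; *-comm; *-assoc; *-suc; *-zeroʳ; *-identityˡ; *-distribˡ-+; *-cancelˡ-≡; m*n≢0;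
   m≤m*n; m+n∸m≡n; m+n∸n≡m; ^-*-assoc; ^-distribˡ-+-*; m^n≢0; m≤n⇒∃[o]m+o≡n)
open import Data.Nat.Solver using (module +-*-Solver)
open +-*-Solver using (Polynomial; solve; con; _:+_; _:*_; _:^_; _:=_)
open import Data.Product.Base using (_,_; _×_; proj₁; proj₂; ∃-syntax)
open import Data.Vec.Functional using (Vector; tail) renaming (_∷_ to _◂_)
open import Function.Base using (_∘_)
open import Function.Bundles using (Inverse; mk⇔)
open import Function.Definitions using (Injective)
open import Level using (Level)
open import Relation.Binary.Bundles using (Setoid)
open import Relation.Binary.Core using (Rel)
open import Relation.Binary.Definitions using () renaming (Decidable to Decidable₂)
open import Relation.Binary.PropositionalEquality using
  (_≡_; _≢_; refl; sym; trans; cong; cong₂; subst; subst₂; module ≡-Reasoning)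
import Relation.Binary.Reasoning.Setoid as SetoidReasoning
open import Relation.Nullary.Decidable.Core using (Dec; yes; no; map′)
open import Relation.Nullary.Negation.Core using (¬_; contradiction)
open import Relation.Unary using (Pred; Decidable; _∈_; _∉_; _⊆_; U; ∁)
open import Relation.Unary.Properties using (∁?)

-- q-analogues of natural numbers

[_]₍_₎ : ℕ → ℕ → ℕ
[ zero  ]₍ x ₎ = 0
[ suc k ]₍ x ₎ = 1 + x * [ k ]₍ x ₎

-- The geometric series x^k - 1 = (x - 1)[k], freed of subtraction. The base is kept general because
-- `[*]` also uses it at `q ^ m`.
^≡1+*[] : ∀ {x y} → x ≡ 1 + y → ∀ k → x ^ k ≡ 1 + y * [ k ]₍ x ₎
^≡1+*[] {y = y} refl zero    = sym (cong suc (*-zeroʳ y))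
^≡1+*[] {y = y} refl (suc k) = trans (cong (suc y *_) (^≡1+*[] refl k))
  (solve 2 (λ y g → (con 1 :+ y) :* (con 1 :+ y :* g) := con 1 :+ y :* (con 1 :+ (con 1 :+ y) :* g))
    refl y [ k ]₍ suc y ₎)

-- Solver syntax for the q-number: at a numeral `k` it evaluates to `[ k ]₍ x ₎` itself.
geo : ∀ {n} → Polynomial n → ℕ → Polynomial n
geo x zero    = con 0
geo x (suc k) = con 1 :+ x :* geo x k

-- The number of ways to extend n independent vectors of a d-dimensional space
-- over GF(q) by j further ones, keeping independence.
frames : ℕ → ℕ → ℕ → ℕ → ℕ
frames q d n zero    = 1
frames q d n (suc j) = frames q d n j * (q ^ d ∸ q ^ (j + n))

module _ (q r : ℕ) .{{_ : NonZero r}} (q≡1+r : q ≡ 1 + r) where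

  -- q² - q + 1 without subtraction.
  Φ₆ : ℕ
  Φ₆ = 1 + r * q

  instance
    q≢0 : NonZero q
    q≢0 = subst NonZero (sym q≡1+r) _

  -- Multiplied by `r` and increased by 1, both sides become `q ^ (k * m)`, read once as a power of
  -- `q` and once as a power of `q ^ m`.
  [*] : ∀ k m → [ k * m ]₍ q ₎ ≡ [ m ]₍ q ₎ * [ k ]₍ q ^ m ₎
  [*] k m = *-cancelˡ-≡ _ _ r (suc-injective (begin
    1 + r * [ k * m ]₍ q ₎                     ≡⟨ ^≡1+*[] q≡1+r (k * m) ⟨
    q ^ (k * m)                                ≡⟨ cong (q ^_) (*-comm k m) ⟩
    q ^ (m * k)                                ≡⟨ ^-*-assoc q m k ⟨
    (q ^ m) ^ k                                ≡⟨ ^≡1+*[] (^≡1+*[] q≡1+r m) k ⟩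
    1 + r * [ m ]₍ q ₎ * [ k ]₍ q ^ m ₎        ≡⟨ cong suc (*-assoc r _ _) ⟩
    1 + r * ([ m ]₍ q ₎ * [ k ]₍ q ^ m ₎)      ∎))
    where open ≡-Reasoning

  ^∸^≡ : ∀ j k → q ^ (j + k) ∸ q ^ j ≡ q ^ j * r * [ k ]₍ q ₎
  ^∸^≡ j k = begin
    q ^ (j + k) ∸ q ^ j                          ≡⟨ cong (_∸ q ^ j) (^-distribˡ-+-* q j k) ⟩
    q ^ j * q ^ k ∸ q ^ j                        ≡⟨ cong (λ z → q ^ j * z ∸ q ^ j) (^≡1+*[] q≡1+r k) ⟩
    q ^ j * (1 + r * [ k ]₍ q ₎) ∸ q ^ j         ≡⟨ cong (_∸ q ^ j) (*-suc (q ^ j) (r * [ k ]₍ q ₎)) ⟩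
    q ^ j + q ^ j * (r * [ k ]₍ q ₎) ∸ q ^ j     ≡⟨ m+n∸m≡n (q ^ j) _ ⟩
    q ^ j * (r * [ k ]₍ q ₎)                     ≡⟨ *-assoc (q ^ j) r _ ⟨
    q ^ j * r * [ k ]₍ q ₎                       ∎
    where open ≡-Reasoning

  -- Residues modulo Φ₆

  Φ₆∣1+q²+q⁴ : Φ₆ ∣ 1 + q ^ 2 + q ^ 4
  Φ₆∣1+q²+q⁴ = divides (1 + q + q ^ 2) (helper r q≡1+r)
    where
    -- With `q` generalised, the equation can be matched by `refl`, which leaves a polynomial
    -- identity in `r` alone.
    helper : ∀ r {q} → q ≡ 1 + r → 1 + q ^ 2 + q ^ 4 ≡ (1 + q + q ^ 2) * (1 + r * q)
    helper r refl = solve 1 (λ r → let q = con 1 :+ r in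
      con 1 :+ q :^ 2 :+ q :^ 4 := (con 1 :+ q :+ q :^ 2) :* (con 1 :+ r :* q)) refl r

  Φ₆∣1+q³ : Φ₆ ∣ 1 + q ^ 3
  Φ₆∣1+q³ = divides (1 + q) (helper r q≡1+r)
    where
    helper : ∀ r {q} → q ≡ 1 + r → 1 + q ^ 3 ≡ (1 + q) * (1 + r * q)
    helper r refl = solve 1 (λ r → let q = con 1 :+ r in
      con 1 :+ q :^ 3 := (con 1 :+ q) :* (con 1 :+ r :* q)) refl r

  1+q²≡Φ₆+q : 1 + q ^ 2 ≡ Φ₆ + q
  1+q²≡Φ₆+q = helper r q≡1+r
    where
    helper : ∀ r {q} → q ≡ 1 + r → 1 + q ^ 2 ≡ (1 + r * q) + q
    helper r refl = solve 1 (λ r → let q = con 1 :+ r in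
      con 1 :+ q :^ 2 := (con 1 :+ r :* q) :+ q) refl r

  -- From 1 + q⁴ + q⁸ = (1 + q² + q⁴)(1 - q² + q⁴), with the negative term moved to the other side.
  Φ₆∣1+q⁴+q⁸ : Φ₆ ∣ 1 + q ^ 4 + q ^ 8
  Φ₆∣1+q⁴+q⁸ = ∣m+n∣m⇒∣n
    (subst (Φ₆ ∣_)
      (solve 1 (λ q → (con 1 :+ q :^ 2 :+ q :^ 4) :* (con 1 :+ q :^ 4)
        := q :^ 2 :* (con 1 :+ q :^ 2 :+ q :^ 4) :+ (con 1 :+ q :^ 4 :+ q :^ 8)) refl q)
      (∣m⇒∣m*n (1 + q ^ 4) Φ₆∣1+q²+q⁴))
    (∣n⇒∣m*n (q ^ 2) Φ₆∣1+q²+q⁴)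

  -- q³ ≡ -1 modulo Φ₆, so exponents can be lowered by 3.
  Φ₆∣q^3k⇒Φ₆∣1 : ∀ k → Φ₆ ∣ q ^ (k * 3) → Φ₆ ∣ 1
  Φ₆∣q^3k⇒Φ₆∣1 zero    d = d
  Φ₆∣q^3k⇒Φ₆∣1 (suc k) d = Φ₆∣q^3k⇒Φ₆∣1 k (∣m+n∣m⇒∣n
    (subst (Φ₆ ∣_) (trans (*-suc (q ^ (k * 3)) (q ^ 3)) (+-comm (q ^ (k * 3)) _)) (∣n⇒∣m*n (q ^ (k * 3)) Φ₆∣1+q³))
    (subst (Φ₆ ∣_) (trans (^-distribˡ-+-* q 3 (k * 3)) (*-comm (q ^ 3) _)) d))

  -- The terms after the first are grouped in pairs, each a multiple of 1 + q³, so only 1 survives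
  -- modulo Φ₆.
  [7]≡ : [ 7 ]₍ q ^ 3 ₎ ≡ (1 + q ^ 3) * (q ^ 3 * (1 + q ^ 6 + q ^ 12)) + 1
  [7]≡ = solve 1 (λ q → geo (q :^ 3) 7 :=
    (con 1 :+ q :^ 3) :* (q :^ 3 :* (con 1 :+ q :^ 6 :+ q :^ 12)) :+ con 1) refl q

  -- Adding q¹⁴ completes the last two terms q¹² + q¹⁶ to a multiple of 1 + q² + q⁴.
  [5]≡ : [ 5 ]₍ q ^ 4 ₎ + q ^ 14 ≡ (1 + q ^ 4 + q ^ 8) + q ^ 12 * (1 + q ^ 2 + q ^ 4)
  [5]≡ = solve 1 (λ q → geo (q :^ 4) 5 :+ q :^ 14 :=
    (con 1 :+ q :^ 4 :+ q :^ 8) :+ q :^ 12 :* (con 1 :+ q :^ 2 :+ q :^ 4)) refl q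

  -- Nine of the eleven terms form three multiples of 1 + q² + q⁴. The remaining 1 + q² is congruent
  -- to q by `1+q²≡Φ₆+q`.
  [11]≡ : [ 11 ]₍ q ^ 2 ₎ ≡ (1 + q ^ 2 + q ^ 4) * (1 + q ^ 6 + q ^ 12) + q ^ 18 * (1 + q ^ 2)
  [11]≡ = solve 1 (λ q → geo (q :^ 2) 11 :=
    (con 1 :+ q :^ 2 :+ q :^ 4) :* (con 1 :+ q :^ 6 :+ q :^ 12) :+ q :^ 18 :* (con 1 :+ q :^ 2)) refl q

  -- Modulo Φ₆ the three factors are q¹⁹, 1 and -q¹⁴.
  Φ₆∣[11][7][5]⇒Φ₆∣1 : Φ₆ ∣ [ 11 ]₍ q ^ 2 ₎ * [ 7 ]₍ q ^ 3 ₎ * [ 5 ]₍ q ^ 4 ₎ → Φ₆ ∣ 1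
  -- The exponents add up to 19 + 14 = 11 · 3, so lowering by 3 eleven times ends at q⁰.
  Φ₆∣[11][7][5]⇒Φ₆∣1 d = Φ₆∣q^3k⇒Φ₆∣1 11 (subst (Φ₆ ∣_) (sym (^-distribˡ-+-* q 19 14)) d₃)
    where
    -- Replaces the first factor by its residue `v`, the difference `u` being a multiple of Φ₆.
    remove : ∀ {x y z} u v → Φ₆ ∣ u → x ≡ u + v → Φ₆ ∣ x * y * z → Φ₆ ∣ v * y * z
    remove {x} {y} {z} u v h refl e = ∣m+n∣m⇒∣n
      (subst (Φ₆ ∣_) (solve 4 (λ u v y z → (u :+ v) :* y :* z := u :* (y :* z) :+ v :* y :* z) refl u v y z) e)
      (∣m⇒∣m*n (y * z) h)
    rotate : ∀ x y z → Φ₆ ∣ x * y * z → Φ₆ ∣ y * x * z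
    rotate x y z = subst (λ w → Φ₆ ∣ w * z) (*-comm x y)
    d₁ : Φ₆ ∣ q ^ 19 * [ 7 ]₍ q ^ 3 ₎ * [ 5 ]₍ q ^ 4 ₎
    d₁ = remove {y = [ 7 ]₍ q ^ 3 ₎} {z = [ 5 ]₍ q ^ 4 ₎}
      ((1 + q ^ 2 + q ^ 4) * (1 + q ^ 6 + q ^ 12) + q ^ 18 * Φ₆) (q ^ 19)
      (∣m∣n⇒∣m+n (∣m⇒∣m*n _ Φ₆∣1+q²+q⁴) (n∣m*n (q ^ 18)))
      (trans [11]≡ (trans (cong (λ w → (1 + q ^ 2 + q ^ 4) * (1 + q ^ 6 + q ^ 12) + q ^ 18 * w) 1+q²≡Φ₆+q)
        (solve 3 (λ e n q → e :+ q :^ 18 :* (n :+ q) := e :+ q :^ 18 :* n :+ q :^ 19) refl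
          ((1 + q ^ 2 + q ^ 4) * (1 + q ^ 6 + q ^ 12)) Φ₆ q)))
      d
    d₂ : Φ₆ ∣ 1 * q ^ 19 * [ 5 ]₍ q ^ 4 ₎
    d₂ = remove {y = q ^ 19} {z = [ 5 ]₍ q ^ 4 ₎} _ 1 (∣m⇒∣m*n _ Φ₆∣1+q³) [7]≡ (rotate (q ^ 19) [ 7 ]₍ q ^ 3 ₎ [ 5 ]₍ q ^ 4 ₎ d₁)
    d₃ : Φ₆ ∣ q ^ 19 * q ^ 14
    d₃ = ∣m+n∣m⇒∣n
      (subst (Φ₆ ∣_) (*-distribˡ-+ (q ^ 19) [ 5 ]₍ q ^ 4 ₎ (q ^ 14))
        (∣n⇒∣m*n (q ^ 19) (subst (Φ₆ ∣_) (sym [5]≡) (∣m∣n⇒∣m+n Φ₆∣1+q⁴+q⁸ (∣n⇒∣m*n (q ^ 12) Φ₆∣1+q²+q⁴)))))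
      (subst (λ w → Φ₆ ∣ w * [ 5 ]₍ q ^ 4 ₎) (*-identityˡ (q ^ 19)) d₂)

  -- Here [3] in base q² is 1 + q² + q⁴, the product of the third and sixth cyclotomic values.
  [6]≡ : [ 6 ]₍ q ₎ ≡ [ 2 ]₍ q ₎ * ([ 3 ]₍ q ₎ * Φ₆)
  [6]≡ = trans ([*] 3 2) (cong ([ 2 ]₍ q ₎ *_) (helper r q≡1+r))
    where
    helper : ∀ r {q} → q ≡ 1 + r → [ 3 ]₍ q ^ 2 ₎ ≡ [ 3 ]₍ q ₎ * (1 + r * q)
    helper r refl = solve 1 (λ r → let q = con 1 :+ r in
      geo (q :^ 2) 3 := geo q 3 :* (con 1 :+ r :* q)) refl r

  -- As 22 = 11 · 2, 21 = 7 · 3 and 20 = 5 · 4, the right side releases [2], [3] and [4]. On the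
  -- left, [2] and [3] come from [6]. Of the remaining divisor Φ₆[5], only Φ₆ is kept.
  [6][5][4]∤[22][21][20] : ¬ ([ 6 ]₍ q ₎ * [ 5 ]₍ q ₎ * [ 4 ]₍ q ₎ ∣ [ 22 ]₍ q ₎ * [ 21 ]₍ q ₎ * [ 20 ]₍ q ₎)
  [6][5][4]∤[22][21][20] d = contradiction
    (∣1⇒≡1 (Φ₆∣[11][7][5]⇒Φ₆∣1 (m*n∣⇒m∣ Φ₆ [ 5 ]₍ q ₎
      (*-cancelˡ-∣ ([ 2 ]₍ q ₎ * [ 3 ]₍ q ₎ * [ 4 ]₍ q ₎) (subst₂ _∣_ lhs rhs d)))))
    Φ₆≢1
    where
    Φ₆≢1 : Φ₆ ≢ 1
    Φ₆≢1 e = ≢-nonZero⁻¹ (r * q) {{m*n≢0 r q}} (suc-injective e)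
    lhs : [ 6 ]₍ q ₎ * [ 5 ]₍ q ₎ * [ 4 ]₍ q ₎ ≡ [ 2 ]₍ q ₎ * [ 3 ]₍ q ₎ * [ 4 ]₍ q ₎ * (Φ₆ * [ 5 ]₍ q ₎)
    lhs = trans (cong (λ w → w * [ 5 ]₍ q ₎ * [ 4 ]₍ q ₎) [6]≡)
      (solve 5 (λ a b c d e → a :* (b :* e) :* d :* c := a :* b :* c :* (e :* d)) refl
        [ 2 ]₍ q ₎ [ 3 ]₍ q ₎ [ 4 ]₍ q ₎ [ 5 ]₍ q ₎ Φ₆)
    rhs : [ 22 ]₍ q ₎ * [ 21 ]₍ q ₎ * [ 20 ]₍ q ₎ ≡
          [ 2 ]₍ q ₎ * [ 3 ]₍ q ₎ * [ 4 ]₍ q ₎ * ([ 11 ]₍ q ^ 2 ₎ * [ 7 ]₍ q ^ 3 ₎ * [ 5 ]₍ q ^ 4 ₎)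
    rhs = trans (cong₂ _*_ (cong₂ _*_ ([*] 11 2) ([*] 7 3)) ([*] 5 4))
      (solve 6 (λ a b c x y z → (a :* x) :* (b :* y) :* (c :* z) := a :* b :* c :* (x :* y :* z)) refl
        [ 2 ]₍ q ₎ [ 3 ]₍ q ₎ [ 4 ]₍ q ₎ [ 11 ]₍ q ^ 2 ₎ [ 7 ]₍ q ^ 3 ₎ [ 5 ]₍ q ^ 4 ₎)

  -- Both products subtract the same powers q², q³, q⁴, so they share the factor `c`. What is left
  -- are q-numbers of the differences 6, 5, 4 and 22, 21, 20.
  frames-∤ : ¬ (frames q 8 2 3 ∣ frames q 24 2 3)
  frames-∤ d = [6][5][4]∤[22][21][20]
    (*-cancelˡ-∣ c {{m*n≢0 _ _ {{m*n≢0 _ _ {{c≢0 2}} {{c≢0 3}}}} {{c≢0 4}}}} (subst₂ _∣_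
      (factor 6 5 4) (factor 22 21 20) d))
    where
    c≢0 : ∀ j → NonZero (q ^ j * r)
    c≢0 j = m*n≢0 (q ^ j) r {{m^n≢0 q j}}
    c : ℕ
    c = q ^ 2 * r * (q ^ 3 * r) * (q ^ 4 * r)
    factor : ∀ k l m →
             1 * (q ^ (2 + k) ∸ q ^ 2) * (q ^ (3 + l) ∸ q ^ 3) * (q ^ (4 + m) ∸ q ^ 4) ≡
             c * ([ k ]₍ q ₎ * [ l ]₍ q ₎ * [ m ]₍ q ₎)
    factor k l m = trans
      (cong₂ _*_ (cong₂ _*_ (cong (1 *_) (^∸^≡ 2 k)) (^∸^≡ 3 l)) (^∸^≡ 4 m))
      (solve 6 (λ x y z k l m → con 1 :* (x :* k) :* (y :* l) :* (z :* m)
        := x :* y :* z :* (k :* l :* m)) refl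
        (q ^ 2 * r) (q ^ 3 * r) (q ^ 4 * r) [ k ]₍ q ₎ [ l ]₍ q ₎ [ m ]₍ q ₎)

-- Counting in lists

private variable
  α β π ρ σ : Level
  A : Set α
  B : Set β

count : {P : Pred A π} → Decidable P → List A → ℕ
count P? xs = length (filter P? xs)

count-accept : {P : Pred A π} (P? : Decidable P) → ∀ {x} xs → P x → count P? (x ∷ xs) ≡ suc (count P? xs)
count-accept P? xs px = cong length (filter-accept P? px)

count-reject : {P : Pred A π} (P? : Decidable P) → ∀ {x} xs → ¬ P x → count P? (x ∷ xs) ≡ count P? xs
count-reject P? xs ¬px = cong length (filter-reject P? ¬px)

count-≐ : {P : Pred A π} (P? : Decidable P) {Q : Pred A σ} (Q? : Decidable Q) → P ⊆ Q → Q ⊆ P →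
          ∀ xs → count P? xs ≡ count Q? xs
count-≐ P? Q? P⊆Q Q⊆P xs = cong length (filter-≐ P? Q? (P⊆Q , Q⊆P) xs)

count-all : {P : Pred A π} (P? : Decidable P) → ∀ {xs} → All P xs → count P? xs ≡ length xs
count-all P? pxs = cong length (filter-all P? pxs)

count-none : {P : Pred A π} (P? : Decidable P) → ∀ {xs} → All (∁ P) xs → count P? xs ≡ 0
count-none P? ¬pxs = cong length (filter-none P? ¬pxs)

count-+-∁ : {P : Pred A π} (P? : Decidable P) → ∀ xs → count P? xs + count (∁? P?) xs ≡ length xs
count-+-∁ P? [] = refl
count-+-∁ P? (x ∷ xs) with ih ← count-+-∁ P? xs | P? x
... | yes _ = cong suc ih
... | no  _ = trans (+-suc _ _) (cong suc ih)

count-filter-∁ : {P : Pred A π} (P? : Decidable P) {Q : Pred A σ} (Q? : Decidable Q) →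
                 ∀ {xs} → All (λ x → Q x → ¬ P x) xs → count Q? (filter (∁? P?) xs) ≡ count Q? xs
count-filter-∁ P? Q? []                           = refl
count-filter-∁ P? Q? {x ∷ xs} (disjoint ∷ rest) with ih ← count-filter-∁ P? Q? rest | P? x
... | yes px = trans ih (sym (count-reject Q? xs λ qx → disjoint qx px))
... | no  _ with Q? x
...   | yes _ = cong suc ih
...   | no  _ = ih

-- Whole equivalence classes are stripped off one at a time. Reflexivity and the Euclidean law
-- together give symmetry and transitivity on `P`. The recursion runs on a length bound, since the
-- remainder is a filtered list.
∣count⇒∣length : {P : Pred A π} {R : Rel A ρ} (R? : ∀ {x} → P x → Decidable (R x)) →
                 (∀ {x} → P x → R x x) →
                 (∀ {x y z} → P x → P y → P z → R x z → R y z → R x y) →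
                 ∀ {n} xs → All P xs → (∀ {x} (px : P x) → n ∣ count (R? px) xs) → n ∣ length xs
∣count⇒∣length {P = P} {R} R? R-refl R-eucl {n} xs = go (length xs) xs ≤-refl
  where
  go : ∀ k xs → length xs ≤ k → All P xs → (∀ {x} (px : P x) → n ∣ count (R? px) xs) → n ∣ length xs
  go k       []       _   _           _ = n ∣0
  go (suc k) (x ∷ xs) len (px ∷ pxs) n∣class = subst (n ∣_) (count-+-∁ (R? px) (x ∷ xs))
    (∣m∣n⇒∣m+n (n∣class px) (go k others
      -- By reflexivity `x` leaves with its own class, so the remainder is no longer than the tail.
      (subst (_≤ k) (sym (cong length (filter-reject (∁? (R? px)) (λ ¬r → ¬r (R-refl px)))))
        (≤-trans (length-filter (∁? (R? px)) xs) (s≤s⁻¹ len)))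
      (All.filter⁺ (∁? (R? px)) (px ∷ pxs))
      n∣class′))
    where
    others : List _
    others = filter (∁? (R? px)) (x ∷ xs)
    n∣class′ : ∀ {y} (py : P y) → n ∣ count (R? py) others
    -- The class of `y` is either the one removed, now empty, or disjoint from it and so unchanged.
    -- The inner `R-eucl` with `R-refl` is symmetry.
    n∣class′ {y} py with R? px y
    ... | yes xy = subst (n ∣_) (sym (count-none (R? py) (All.zipWith
            (λ (pz , ¬xz) yz → ¬xz (R-eucl px pz py xy (R-eucl pz py pz (R-refl pz) yz)))
            (All.filter⁺ (∁? (R? px)) (px ∷ pxs) , All.all-filter (∁? (R? px)) (x ∷ xs))))) (n ∣0)
    ... | no ¬xy = subst (n ∣_) (sym (count-filter-∁ (R? px) (R? py)
            (All.map (λ pz yz xz → ¬xy (R-eucl px py pz xz yz)) (px ∷ pxs)))) (n∣class py)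

-- The filtered list and the list of images are duplicate-free with the same members, hence
-- permutations of each other.
count-image : ∀ {m n} {P : Pred (Fin n) π} (P? : Decidable P) (f : Fin m → Fin n) → Injective _≡_ _≡_ f →
              (∀ k → P (f k)) → (∀ {i} → P i → ∃[ k ] i ≡ f k) → count P? (allFin n) ≡ m
count-image {m = m} {n} {P} P? f f-inj P-f f-onto = trans (↭-length (∼bag⇒↭ (unique∧set⇒bag
    (Unique.filter⁺ P? (Unique.allFin⁺ n))
    (Unique.map⁺ f-inj (Unique.allFin⁺ m))
    (mk⇔ to from))))
  (trans (length-map f (allFin m)) (length-tabulate {n = m} (λ i → i)))
  where
  to : ∀ {i} → i ∈ₗ filter P? (allFin n) → i ∈ₗ map f (allFin m)
  to i∈ with k , refl ← f-onto (proj₂ (∈-filter⁻ P? {xs = allFin n} i∈)) = ∈-map⁺ f (∈-allFin k)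
  from : ∀ {i} → i ∈ₗ map f (allFin m) → i ∈ₗ filter P? (allFin n)
  from i∈ with k , _ , refl ← ∈-map⁻ f i∈ = ∈-filter⁺ P? (∈-allFin (f k)) (P-f k)

count-∖ : {P : Pred A π} (P? : Decidable P) {Q : Pred A σ} (Q? : Decidable Q) → P ⊆ Q →
          ∀ xs → count Q? (filter (∁? P?) xs) ≡ count Q? xs ∸ count P? xs
count-∖ P? Q? P⊆Q xs = trans (sym (m+n∸n≡m _ (count P? xs))) (cong (_∸ count P? xs) (go xs))
  where
  go : ∀ xs → count Q? (filter (∁? P?) xs) + count P? xs ≡ count Q? xs
  go []       = refl
  go (x ∷ xs) with ih ← go xs | P? x
  ... | yes px = trans (+-suc _ _) (trans (cong suc ih) (sym (count-accept Q? xs (P⊆Q px))))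
  ... | no  _ with Q? x
  ...   | yes _ = cong suc ih
  ...   | no  _ = ih

count-map : (f : A → B) {Q : Pred B σ} (Q? : Decidable Q) → ∀ xs → count Q? (map f xs) ≡ count (Q? ∘ f) xs
count-map f Q? []       = refl
count-map f Q? (x ∷ xs) with Q? (f x)
... | yes _ = cong suc (count-map f Q? xs)
... | no  _ = count-map f Q? xs

-- Serves to count tuples by their last choice. The value `k` is required only at listed elements,
-- because in the application it rests on their independence.
count-concatMap : (f : A → List B) {P : Pred A π} (P? : Decidable P) {Q : Pred B σ} (Q? : Decidable Q) →
                  ∀ {k} xs → All (λ x → P x → count Q? (f x) ≡ k) xs → (∀ x → ¬ P x → count Q? (f x) ≡ 0) →
                  count Q? (concatMap f xs) ≡ count P? xs * k
count-concatMap f P? Q? []       []         h₀ = refl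
count-concatMap f P? Q? (x ∷ xs) (h ∷ hs) h₀ = trans (cong length (filter-++ Q? (f x) _))
  (trans (length-++ (filter Q? (f x))) (step (P? x)))
  where
  ih = count-concatMap f P? Q? xs hs h₀
  step : Dec _ → _
  step (yes px) = trans (cong₂ _+_ (h px) ih) (cong (_* _) (sym (count-accept P? xs px)))
  step (no ¬px) = trans (cong₂ _+_ (h₀ x ¬px) ih) (cong (_* _) (sym (count-reject P? xs ¬px)))

-- Subspaces of a finite vector space

module LinearAlgebra {c ℓ₁ ℓ₂ m ℓm : Level} (F : HeytingField c ℓ₁ ℓ₂) (V : VectorSpace F m ℓm) where

  open HeytingField F using (_≈_; -_; 0#; 1#; -‿inverseʳ; #⇒invertible; tight; heytingCommutativeRing)
    renaming (Carrier to K; sym to ≈-sym; trans to ≈-trans; +-congˡ to +ₖ-congˡ; +-identityʳ to +ₖ-identityʳ;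
              *-congˡ to *ₖ-congˡ; _+_ to _+ₖ_; _*_ to _*ₖ_)
  private module K = CommutativeRing (HeytingCommutativeRing.commutativeRing heytingCommutativeRing)
  open import Algebra.Properties.Ring K.ring using (-1*x≈-x)
  open import Algebra.Properties.Group K.+-group using (x∙y⁻¹≈ε⇒x≈y; ε⁻¹≈ε)
  open Module V
  open Sum +ᴹ-commutativeMonoid using (sum-cong-≋; ∑-distrib-+)
  open Subspace using (⟦_⟧; resp-≈ᴹ; 0ᴹ-closed; +ᴹ-closed; *ₗ-closed)
  open SetoidReasoning ≈ᴹ-setoid

  private variable
    n d : ℕ

  lc : Vector K n → Vector Carrierᴹ n → Carrierᴹ
  lc = linearCombination F V

  Independent : Vector Carrierᴹ n → Set _
  Independent v = ∀ a → lc a v ≈ᴹ 0ᴹ → ∀ i → a i ≈ 0#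

  lc-cong : ∀ {a b : Vector K n} v → (∀ i → a i ≈ b i) → lc a v ≈ᴹ lc b v
  lc-cong v a≈b = sum-cong-≋ (λ i → *ₗ-congʳ (a≈b i))

  lc-0 : ∀ (v : Vector Carrierᴹ n) → lc (λ _ → 0#) v ≈ᴹ 0ᴹ
  lc-0 {zero}  v = ≈ᴹ-refl
  lc-0 {suc n} v = ≈ᴹ-trans (+ᴹ-cong (*ₗ-zeroˡ _) (lc-0 (tail v))) (+ᴹ-identityˡ 0ᴹ)

  lc-+ : ∀ a b (v : Vector Carrierᴹ n) → lc (λ i → a i +ₖ b i) v ≈ᴹ lc a v +ᴹ lc b v
  lc-+ a b v = ≈ᴹ-trans (sum-cong-≋ λ i → *ₗ-distribʳ (v i) (a i) (b i)) (∑-distrib-+ (λ i → a i *ₗ v i) (λ i → b i *ₗ v i))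

  lc-* : ∀ k a (v : Vector Carrierᴹ n) → lc (λ i → k *ₖ a i) v ≈ᴹ k *ₗ lc a v
  lc-* {zero}  k a v = ≈ᴹ-sym (*ₗ-zeroʳ k)
  lc-* {suc n} k a v = ≈ᴹ-trans (+ᴹ-cong (*ₗ-assoc k _ _) (lc-* k (tail a) (tail v))) (≈ᴹ-sym (*ₗ-distribˡ k _ _))

  y+-1*y≈0 : ∀ y → y +ᴹ (- 1#) *ₗ y ≈ᴹ 0ᴹ
  y+-1*y≈0 y = begin
    y +ᴹ (- 1#) *ₗ y           ≈⟨ +ᴹ-congʳ (*ₗ-identityˡ y) ⟨
    1# *ₗ y +ᴹ (- 1#) *ₗ y     ≈⟨ *ₗ-distribʳ y 1# (- 1#) ⟨
    (1# +ₖ - 1#) *ₗ y          ≈⟨ *ₗ-congʳ (-‿inverseʳ 1#) ⟩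
    0# *ₗ y                    ≈⟨ *ₗ-zeroˡ y ⟩
    0ᴹ                         ∎

  lc-injective : ∀ {v : Vector Carrierᴹ n} → Independent v → ∀ {a b} → lc a v ≈ᴹ lc b v → ∀ i → a i ≈ b i
  lc-injective {v = v} ind {a} {b} eq i = x∙y⁻¹≈ε⇒x≈y (a i) (b i)
    (≈-trans (+ₖ-congˡ (≈-sym (-1*x≈-x (b i)))) (ind (λ i → a i +ₖ - 1# *ₖ b i) (begin
      lc (λ i → a i +ₖ - 1# *ₖ b i) v      ≈⟨ lc-+ a (λ i → - 1# *ₖ b i) v ⟩
      lc a v +ᴹ lc (λ i → - 1# *ₖ b i) v   ≈⟨ +ᴹ-cong eq (lc-* (- 1#) b v) ⟩
      lc b v +ᴹ (- 1#) *ₗ lc b v           ≈⟨ y+-1*y≈0 (lc b v) ⟩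
      0ᴹ                                   ∎) i))

  span : Vector Carrierᴹ n → Subspace F V
  span v = record
    { ⟦_⟧       = λ x → ∃[ a ] x ≈ᴹ lc a v
    ; resp-≈ᴹ   = λ { x≈y (a , eq) → a , ≈ᴹ-trans (≈ᴹ-sym x≈y) eq }
    ; 0ᴹ-closed = (λ _ → 0#) , ≈ᴹ-sym (lc-0 v)
    ; +ᴹ-closed = λ { (a , p) (b , q) → (λ i → a i +ₖ b i) , ≈ᴹ-trans (+ᴹ-cong p q) (≈ᴹ-sym (lc-+ a b v)) }
    ; *ₗ-closed = λ { k (a , p) → (λ i → k *ₖ a i) , ≈ᴹ-trans (*ₗ-congˡ p) (≈ᴹ-sym (lc-* k a v)) }
    }

  ∈-span : ∀ (v : Vector Carrierᴹ n) i → v i ∈ ⟦ span v ⟧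
  ∈-span {suc n} v zero    = (1# ◂ λ _ → 0#) , ≈ᴹ-sym (≈ᴹ-trans (+ᴹ-cong (*ₗ-identityˡ _) (lc-0 (tail v))) (+ᴹ-identityʳ _))
  ∈-span {suc n} v (suc i) with a , eq ← ∈-span (tail v) i =
    (0# ◂ a) , ≈ᴹ-trans eq (≈ᴹ-sym (≈ᴹ-trans (+ᴹ-congʳ (*ₗ-zeroˡ _)) (+ᴹ-identityˡ _)))

  span-⊆ : ∀ (W : Subspace F V) (v : Vector Carrierᴹ n) → (∀ i → v i ∈ ⟦ W ⟧) → ⟦ span v ⟧ ⊆ ⟦ W ⟧
  span-⊆ {n} W v v∈W (a , eq) = resp-≈ᴹ W (≈ᴹ-sym eq) (go n a v v∈W)
    where
    go : ∀ n a (v : Vector Carrierᴹ n) → (∀ i → v i ∈ ⟦ W ⟧) → lc a v ∈ ⟦ W ⟧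
    go zero    a v v∈W = 0ᴹ-closed W
    go (suc n) a v v∈W = +ᴹ-closed W (*ₗ-closed W (a zero) (v∈W zero)) (go n (tail a) (tail v) (v∈W ∘ suc))

  tail-independent : ∀ {v : Vector Carrierᴹ (suc n)} → Independent v → Independent (tail v)
  tail-independent ind a eq i = ind (0# ◂ a) (≈ᴹ-trans (+ᴹ-congʳ (*ₗ-zeroˡ _)) (≈ᴹ-trans (+ᴹ-identityˡ _) eq)) (suc i)

  drop-independent : ∀ j {v : Vector Carrierᴹ (j + n)} → Independent v → Independent (v ∘ (j ↑ʳ_))
  drop-independent zero    ind = ind
  drop-independent (suc j) {v} ind = drop-independent j {tail v} (tail-independent {v = v} ind)

  -- A leading coefficient apart from zero could be inverted, placing `x` in the span of `v`.
  -- Tightness turns this refutation into equality with zero.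
  ◂-independent : ∀ {x} {v : Vector Carrierᴹ n} → Independent v → x ∉ ⟦ span v ⟧ → Independent (x ◂ v)
  ◂-independent {x = x} {v} ind x∉ a eq = λ { zero → a₀≈0 ; (suc i) → ind (tail a) rest≈0 i }
    where
    a₀ = a zero
    y = lc (tail a) v
    a₀≈0 : a₀ ≈ 0#
    a₀≈0 = proj₁ (tight a₀ 0#) λ a₀#0 → let b , b*a₀≈1 , _ = #⇒invertible a₀#0 in
      x∉ (resp-≈ᴹ (span v) (begin
        (b *ₖ - 1#) *ₗ y                             ≈⟨ *ₗ-assoc b (- 1#) y ⟩
        b *ₗ (- 1#) *ₗ y                             ≈⟨ *ₗ-congˡ (+ᴹ-identityˡ _) ⟨
        b *ₗ (0ᴹ +ᴹ (- 1#) *ₗ y)                     ≈⟨ *ₗ-congˡ (+ᴹ-congʳ eq) ⟨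
        b *ₗ ((a₀ *ₗ x +ᴹ y) +ᴹ (- 1#) *ₗ y)         ≈⟨ *ₗ-congˡ (+ᴹ-assoc _ _ _) ⟩
        b *ₗ (a₀ *ₗ x +ᴹ (y +ᴹ (- 1#) *ₗ y))         ≈⟨ *ₗ-congˡ (+ᴹ-congˡ (y+-1*y≈0 y)) ⟩
        b *ₗ (a₀ *ₗ x +ᴹ 0ᴹ)                         ≈⟨ *ₗ-congˡ (+ᴹ-identityʳ _) ⟩
        b *ₗ a₀ *ₗ x                                 ≈⟨ *ₗ-assoc b a₀ x ⟨
        -- Invertibility is supplied for the difference of `a₀` and `0#`, hence the padding.
        (b *ₖ a₀) *ₗ x                               ≈⟨ *ₗ-congʳ (*ₖ-congˡ (≈-sym (≈-trans (+ₖ-congˡ ε⁻¹≈ε) (+ₖ-identityʳ a₀)))) ⟩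
        (b *ₖ (a₀ +ₖ - 0#)) *ₗ x                     ≈⟨ *ₗ-congʳ b*a₀≈1 ⟩
        1# *ₗ x                                      ≈⟨ *ₗ-identityˡ x ⟩
        x                                            ∎)
        (*ₗ-closed (span v) (b *ₖ - 1#) (tail a , ≈ᴹ-refl)))
    rest≈0 : y ≈ᴹ 0ᴹ
    rest≈0 = begin
      y                  ≈⟨ +ᴹ-identityˡ y ⟨
      0ᴹ +ᴹ y            ≈⟨ +ᴹ-congʳ (*ₗ-zeroˡ x) ⟨
      0# *ₗ x +ᴹ y       ≈⟨ +ᴹ-congʳ (*ₗ-congʳ a₀≈0) ⟨
      a₀ *ₗ x +ᴹ y       ≈⟨ eq ⟩
      0ᴹ                 ∎

  -- Enumeration of a finite vector space

  module FiniteSpace {q} (size : HasOrder F q) {D} (e : Vector Carrierᴹ D) (basis : IsBasis F V U e) where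

    open Inverse size using ()
      renaming (to to toFin; from to fromFin; to-cong to toFin-cong; from-cong to fromFin-cong;
                strictlyInverseˡ to toFin-fromFin; strictlyInverseʳ to fromFin-toFin)

    _≈?_ : Decidable₂ _≈_
    x ≈? y = map′ (λ eq → ≈-trans (≈-sym (fromFin-toFin x)) (≈-trans (fromFin-cong eq) (fromFin-toFin y)))
      toFin-cong (toFin x ≟ toFin y)

    coords : Carrierᴹ → Vector K D
    coords x = proj₁ (IsBasis.spanning basis {x} _)

    ≈-lc-coords : ∀ x → x ≈ᴹ lc (coords x) e
    ≈-lc-coords x = proj₂ (IsBasis.spanning basis {x} _)

    _≈ᴹ?_ : Decidable₂ _≈ᴹ_
    x ≈ᴹ? y = map′
      (λ eq → ≈ᴹ-trans (≈-lc-coords x) (≈ᴹ-trans (lc-cong e eq) (≈ᴹ-sym (≈-lc-coords y))))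
      (λ x≈y → lc-injective (IsBasis.independent basis) (≈ᴹ-trans (≈ᴹ-sym (≈-lc-coords x)) (≈ᴹ-trans x≈y (≈-lc-coords y))))
      (all? λ i → coords x i ≈? coords y i)

    scalars : Fin (q ^ n) → Vector K n
    scalars k i = fromFin (finToFun k i)

    scalars-surjective : ∀ (a : Vector K n) → ∃[ k ] (∀ i → a i ≈ scalars k i)
    scalars-surjective a = funToFin (toFin ∘ a) , λ i → ≈-trans (≈-sym (fromFin-toFin (a i)))
      (fromFin-cong (sym (finToFun-funToFin (toFin ∘ a) i)))

    scalars-injective : ∀ (k l : Fin (q ^ n)) → (∀ i → scalars k i ≈ scalars l i) → k ≡ l
    scalars-injective {n} k l eq = trans (sym (funToFin-finToFin {n} k)) (trans (funToFin-cong n λ i →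
      trans (sym (toFin-fromFin _)) (trans (toFin-cong (eq i)) (toFin-fromFin _))) (funToFin-finToFin {n} l))
      where
      funToFin-cong : ∀ n {f g : Fin n → Fin q} → (∀ i → f i ≡ g i) → funToFin f ≡ funToFin g
      funToFin-cong zero    f≗g = refl
      funToFin-cong (suc n) f≗g = cong₂ combine (f≗g zero) (funToFin-cong n (f≗g ∘ suc))

    spanned : (v : Vector Carrierᴹ n) → Fin (q ^ n) → Carrierᴹ
    spanned v k = lc (scalars k) v

    spanned-surjective : ∀ (v : Vector Carrierᴹ n) {x} → x ∈ ⟦ span v ⟧ → ∃[ k ] x ≈ᴹ spanned v k
    spanned-surjective v (a , eq) with k , a≈ ← scalars-surjective a = k , ≈ᴹ-trans eq (lc-cong v a≈)

    spanned-injective : ∀ {v : Vector Carrierᴹ n} → Independent v → ∀ {k l} → spanned v k ≈ᴹ spanned v l → k ≡ l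
    spanned-injective ind {k} {l} eq = scalars-injective k l (lc-injective ind eq)

    -- Abstract because unfolding these decisions while comparing counts makes
    -- type checking explode.
    abstract
      _∈span?_ : ∀ x (v : Vector Carrierᴹ n) → Dec (x ∈ ⟦ span v ⟧)
      x ∈span? v = map′ (λ (k , eq) → scalars k , eq) (spanned-surjective v) (any? λ k → x ≈ᴹ? spanned v k)

    _⊆span?_ : ∀ (t : Vector Carrierᴹ n) (v : Vector Carrierᴹ d) → Dec (∀ i → t i ∈ ⟦ span v ⟧)
    t ⊆span? v = all? λ i → t i ∈span? v

    vector : Fin (q ^ D) → Carrierᴹ
    vector = spanned e

    index : ∀ x → ∃[ k ] x ≈ᴹ vector k
    index x = spanned-surjective e (IsBasis.spanning basis {x} _)

    -- Codes are listed instead of vectors: their equality is propositional, and each vector has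
    -- exactly one code up to `_≈ᴹ_`.
    vectors : List (Fin (q ^ D))
    vectors = allFin (q ^ D)

    -- Independence of `v` makes coefficient tuples correspond to the vectors of the span. `index`
    -- carries these to codes, which are unique because the basis is independent.
    count-span : ∀ {v : Vector Carrierᴹ n} → Independent v → count (λ k → vector k ∈span? v) vectors ≡ q ^ n
    count-span {v = v} ind = count-image (λ k → vector k ∈span? v) (λ k → proj₁ (index (spanned v k)))
      (λ {k} {l} eq → spanned-injective ind (≈ᴹ-trans (proj₂ (index (spanned v k)))
        (≈ᴹ-trans (≈ᴹ-reflexive (cong vector eq)) (≈ᴹ-sym (proj₂ (index (spanned v l)))))))
      (λ k → scalars k , ≈ᴹ-sym (proj₂ (index (spanned v k))))
      (λ p → let k , eq = spanned-surjective v p in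
        k , spanned-injective (IsBasis.independent basis) (≈ᴹ-trans eq (proj₂ (index (spanned v k)))))

    -- Extensions of an independent tuple

    extensions : ∀ j → Vector Carrierᴹ n → List (Vector Carrierᴹ (j + n))
    extensions zero    s = s ∷ []
    extensions (suc j) s = concatMap
      (λ t → map (λ k → vector k ◂ t) (filter (∁? (λ k → vector k ∈span? t)) vectors)) (extensions j s)

    -- New vectors are prepended, so `s` remains the final segment, addressed by `_↑ʳ_`.
    IsExtension : ∀ j → Vector Carrierᴹ n → Vector Carrierᴹ (j + n) → Set _
    IsExtension j s t = Independent t × (∀ i → t (j ↑ʳ i) ≡ s i)

    extensions-sound : ∀ j {s : Vector Carrierᴹ n} → Independent s → All (IsExtension j s) (extensions j s)
    extensions-sound zero    ind = (ind , λ _ → refl) ∷ []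
    extensions-sound (suc j) ind = All.concat⁺ (All.map⁺ (All.map
      (λ {t} (t-ind , t-ext) → All.map⁺ (All.map (λ x∉ →
        ◂-independent t-ind x∉ , t-ext) (All.all-filter (∁? (λ k → vector k ∈span? t)) vectors)))
      (extensions-sound j ind)))

    -- An extension inside the span of `w` arises from a shorter one inside it by a vector of that
    -- span outside the span of the `j + n` vectors already chosen.
    count-extensions : ∀ {w : Vector Carrierᴹ d} → Independent w → ∀ j {s : Vector Carrierᴹ n} → Independent s →
                       (∀ i → s i ∈ ⟦ span w ⟧) → count (_⊆span? w) (extensions j s) ≡ frames q d n j
    count-extensions {w = w} w-ind zero    {s} s-ind s⊆w = count-accept (_⊆span? w) [] s⊆w
    count-extensions {d = d} {n = n} {w = w} w-ind (suc j) {s} s-ind s⊆w = trans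
      (count-concatMap _ (_⊆span? w) (_⊆span? w) (extensions j s)
        (All.map (λ {t} (t-ind , _) t⊆w → inside t t-ind t⊆w) (extensions-sound j s-ind)) outside)
      (cong (_* _) (count-extensions w-ind j s-ind s⊆w))
      where
      new : (t : Vector Carrierᴹ (j + n)) → List _
      new t = filter (∁? (λ k → vector k ∈span? t)) vectors
      inside : ∀ t → Independent t → (∀ i → t i ∈ ⟦ span w ⟧) →
               count (_⊆span? w) (map (λ k → vector k ◂ t) (new t)) ≡ q ^ d ∸ q ^ (j + n)
      inside t t-ind t⊆w = trans (count-map (λ k → vector k ◂ t) (_⊆span? w) (new t)) (trans
        -- As `t` already lies in the span of `w`, only the new vector has to be tested.
        (count-≐ (λ k → (vector k ◂ t) ⊆span? w) (λ k → vector k ∈span? w)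
          (λ p → p zero) (λ p → λ { zero → p ; (suc i) → t⊆w i }) (new t))
        (trans (count-∖ (λ k → vector k ∈span? t) (λ k → vector k ∈span? w) (span-⊆ (span w) t t⊆w) vectors)
          (cong₂ _∸_ (count-span w-ind) (count-span t-ind))))
      outside : ∀ t → ¬ (∀ i → t i ∈ ⟦ span w ⟧) → count (_⊆span? w) (map (λ k → vector k ◂ t) (new t)) ≡ 0
      outside t t⊈w = count-none (_⊆span? w) (All.map⁺ (All.universal (λ k p → t⊈w (p ∘ suc)) (new t)))

  -- From a design to a divisibility

  design⇒frames-∣ : ∀ {q b} → HasOrder F q → (𝓑 : Pred (Subspace F V) b) → ∀ i j n k →
             IsSubspaceDesign F V 𝓑 (j + n) (i + n) k 1 → frames q k n j ∣ frames q (i + n) n j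
  design⇒frames-∣ {q} size 𝓑 i j n k design = subst (frames q k n j ∣_) length-extensions
      (∣count⇒∣length {P = IsExtension j s} {R = Coblock} coblock?
        (λ (ind , _) → let W , W∈𝓑 , t⊆W = block ind in W , W∈𝓑 , t⊆W , t⊆W)
        coblock-eucl (extensions j s) (extensions-sound j s-ind)
        (λ ext → subst (frames q k n j ∣_) (sym (count-coblock ext)) ∣-refl))
    where
    open IsSubspaceDesign design
    e = proj₁ dimension
    e-basis = proj₂ dimension
    open FiniteSpace size e e-basis

    e-ind : Independent e
    e-ind = IsBasis.independent e-basis

    -- The fixed tuple consists of the last `n` vectors of the basis, so its independence is
    -- inherited.
    s : Vector Carrierᴹ n
    s = e ∘ (i ↑ʳ_)

    s-ind : Independent s
    s-ind = drop-independent i {e} e-ind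

    -- The whole space is the span of `e`, so the total is the case `w = e` of `count-extensions`.
    length-extensions : length (extensions j s) ≡ frames q (i + n) n j
    length-extensions = trans
      (sym (count-all (_⊆span? e) (All.universal (λ t r → IsBasis.spanning e-basis {t r} _) (extensions j s))))
      (count-extensions e-ind j s-ind (λ r → IsBasis.spanning e-basis {s r} _))

    spanBasis : ∀ {t : Vector Carrierᴹ (j + n)} → Independent t → HasDimension F V ⟦ span t ⟧ (j + n)
    spanBasis {t} ind = t , record { members = ∈-span t ; independent = ind ; spanning = λ x∈ → x∈ }

    block : ∀ {t : Vector Carrierᴹ (j + n)} → Independent t → ∃[ W ] W ∈ 𝓑 × (∀ r → t r ∈ ⟦ W ⟧)
    block {t} ind with W , W∈𝓑 , t⊆W ← Inverse.from (balanced (span t) (spanBasis ind)) zero =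
      W , W∈𝓑 , λ r → t⊆W (∈-span t r)

    -- Both blocks are sent to the only element of `Fin 1`, and the round trips of the inverse
    -- identify them.
    block-unique : ∀ {t : Vector Carrierᴹ (j + n)} → Independent t → ∀ {W W′} → W ∈ 𝓑 → W′ ∈ 𝓑 →
                   (∀ r → t r ∈ ⟦ W ⟧) → (∀ r → t r ∈ ⟦ W′ ⟧) → ⟦ W ⟧ ⊆ ⟦ W′ ⟧
    block-unique {t} ind {W} {W′} W∈𝓑 W′∈𝓑 t⊆W t⊆W′ = proj₁
      (S.trans {x} {from (to x)} {y} (S.sym {from (to x)} {x} (strictlyInverseʳ x))
        (subst (λ z → from z S.≈ y) (fin1 (to y) (to x)) (strictlyInverseʳ y)))
      where
      module S = Setoid (blocksContaining F V 𝓑 (span t))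
      open Inverse (balanced (span t) (spanBasis ind))
      x y : S.Carrier
      x = W , W∈𝓑 , span-⊆ W t t⊆W
      y = W′ , W′∈𝓑 , span-⊆ W′ t t⊆W′
      fin1 : ∀ (a b : Fin 1) → a ≡ b
      fin1 zero zero = refl

    Coblock : Vector Carrierᴹ (j + n) → Vector Carrierᴹ (j + n) → Set _
    Coblock t t′ = ∃[ W ] W ∈ 𝓑 × (∀ r → t r ∈ ⟦ W ⟧) × (∀ r → t′ r ∈ ⟦ W ⟧)

    -- The independent tuple `z` lies in both blocks, which therefore coincide.
    coblock-eucl : ∀ {x y z} → IsExtension j s x → IsExtension j s y → IsExtension j s z →
                   Coblock x z → Coblock y z → Coblock x y
    coblock-eucl _ _ (z-ind , _) (W , W∈𝓑 , x⊆W , z⊆W) (W′ , W′∈𝓑 , y⊆W′ , z⊆W′) =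
      W , W∈𝓑 , x⊆W , λ r → block-unique z-ind {W′} {W} W′∈𝓑 W∈𝓑 z⊆W′ z⊆W (y⊆W′ r)

    -- Presents the block as a span, where membership is decidable.
    blockBasis : ∀ {t} → IsExtension j s t → Vector Carrierᴹ k
    blockBasis (ind , _) = let W , W∈𝓑 , _ = block ind in proj₁ (blockDimension {W} W∈𝓑)

    coblock⇒⊆ : ∀ {t} (ext : IsExtension j s t) {t′} → Coblock t t′ → ∀ r → t′ r ∈ ⟦ span (blockBasis ext) ⟧
    coblock⇒⊆ (ind , _) (W′ , W′∈𝓑 , t⊆W′ , t′⊆W′) r = let W , W∈𝓑 , t⊆W = block ind in
      IsBasis.spanning (proj₂ (blockDimension {W} W∈𝓑)) (block-unique ind {W′} {W} W′∈𝓑 W∈𝓑 t⊆W′ t⊆W (t′⊆W′ r))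

    ⊆⇒coblock : ∀ {t} (ext : IsExtension j s t) {t′} → (∀ r → t′ r ∈ ⟦ span (blockBasis ext) ⟧) → Coblock t t′
    ⊆⇒coblock ext@(ind , _) t′⊆ = let W , W∈𝓑 , t⊆W = block ind in
      W , W∈𝓑 , t⊆W , λ r → span-⊆ W (blockBasis ext) (IsBasis.members (proj₂ (blockDimension {W} W∈𝓑))) (t′⊆ r)

    abstract
      coblock? : ∀ {t} → IsExtension j s t → Decidable (Coblock t)
      coblock? ext t′ = map′ (⊆⇒coblock ext) (coblock⇒⊆ ext) (t′ ⊆span? blockBasis ext)

    count-coblock : ∀ {t} (ext : IsExtension j s t) → count (coblock? ext) (extensions j s) ≡ frames q k n j
    count-coblock {t} ext@(ind , t-ext) = let W , W∈𝓑 , t⊆W = block ind in trans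
      (count-≐ (coblock? ext) (_⊆span? blockBasis ext) (coblock⇒⊆ ext) (⊆⇒coblock ext) (extensions j s))
      (count-extensions (IsBasis.independent (proj₂ (blockDimension {W} W∈𝓑))) j s-ind
        -- The block contains `s` because `s` is the final segment of `t`.
        (λ r → subst (_∈ ⟦ span (blockBasis ext) ⟧) (t-ext r)
          (IsBasis.spanning (proj₂ (blockDimension {W} W∈𝓑)) (t⊆W (j ↑ʳ r)))))

mainTheorem4 : ∀ {c ℓ₁ ℓ₂ m ℓm b : Level} (q : ℕ) → IsPrimePower q →
    (F : HeytingField c ℓ₁ ℓ₂) → HasOrder F q →
    (V : VectorSpace F m ℓm) (𝓑 : Pred (Subspace F V) b) →
    ¬ IsSubspaceDesign F V 𝓑 5 24 8 1
mainTheorem4 q (p , e , p-prime , q≡pᵉ⁺¹) F size V 𝓑 design =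
  -- The arguments encode 24 = 22 + 2 and 5 = 3 + 2 with block dimension 8. The witness for q - 1 is
  -- the successor of `o` in 2 + `o` = `q`, hence nonzero.
  frames-∤ q (suc (proj₁ 2+o≡q)) (sym (proj₂ 2+o≡q)) (LinearAlgebra.design⇒frames-∣ F V size 𝓑 22 3 2 8 design)
  where
  2≤q : 2 ≤ q
  2≤q = subst (2 ≤_) (sym q≡pᵉ⁺¹) (≤-trans (nonTrivial⇒n>1 p {{prime⇒nonTrivial p-prime}}) (m≤m*n p (p ^ e) {{m^n≢0 p e {{prime⇒nonZero p-prime}}}}))
  2+o≡q = m≤n⇒∃[o]m+o≡n 2≤q
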